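{- Let $n,m\ge1$ and $q,\alpha,\beta\in\mathbb N$ with $\gcd(\alpha,\beta)=1$, let $p=\gcd(m,n)$, and let $C(n,q\alpha)\in\{a<z\}^n$ and $C(m,q\beta)\in\{b<z\}^m$ be two superimposable Christoffel words. Let $r$ be an integer with $qr\equiv1\pmod p$. Then for every integer $i$ with $0\le i<\frac mp$, the words $C(n,q\alpha)$ and $\gamma^{ -(r-1)+ip}\,\widetilde C(m,q\beta)$ are perfectly superimposable.
   Context: $\mathbb N=\{0,1,2,\dots\}$. For coprime $s,t\in\mathbb N$ and $n=s+t$, the Christoffel word over the ordered alphabet $\{a<z\}$ with $s$ occurrences of $a$ and $t$ occurrences of $z$ is $u=u[0]u[1]\cdots u[n-1]$ with $u[i]=a$ if $((i+1)t \bmod n)>(it\bmod n)$ and $u[i]=z$ otherwise. It is denoted $C(n,s)$; calling $C(n,s)$ a Christoffel word presupposes $\gcd(n,s)=1$. Over $\{b<z\}$ the definition is the same with $b$ in place of $a$. $\widetilde C(n,s)$ denotes the reversal (mirror image) of $C(n,s)$. For a letter $c$ and a finite word $w$, $\gamma(cw)=wc$; $\gamma$ is a bijection on words of a given length, and $\gamma^k$ is defined for all $k\in\mathbb Z$. Let $u\in\{a,z\}^n$ and $v\in\{b,z\}^m$, let $A$ be the set of positions (indexed from $0$) of the letter $a$ in $u$ and $B$ the set of positions of the letter $b$ in $v$. The words $u,v$ are perfectly superimposable if $(A+n\mathbb Z)\cap(B+m\mathbb Z)=\emptyset$, and superimposable if there is $k\in\mathbb Z$ with $(A+n\mathbb Z)\cap(B-k+m\mathbb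 Z)=\emptyset$ (equivalently, $u$ and $\gamma^k(v)$ are perfectly superimposable for some $k$). -}

module Defs where

open import Data.Bool.Base using (if_then_else_)
open import Data.Fin.Base using (Fin; toℕ)
open import Data.Integer.Base as ℤ using (ℤ; +_; -[1+_])
open import Data.Nat.Base using (ℕ; zero; suc; _*_; _∸_; NonZero; ≢-nonZero; ≢-nonZero⁻¹)
open import Data.Nat.DivMod using (_%_)
open import Data.Nat.GCD using (gcd; gcd[m,n]≢0)
open import Data.Nat.GeneralisedArithmetic using (fold)
open import Data.Nat.Properties using (_>?_)
open import Data.Product.Base using (_×_; ∃-syntax)
open import Data.Sum.Base using (inj₁)
open import Data.Vec.Base using (Vec; []; _∷_; _∷ʳ_; init; last; lookup; tabulate)
open import Data.Vec.Properties using (init-∷ʳ; last-∷ʳ)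
open import Level using (0ℓ)
open import Relation.Binary.PropositionalEquality using (_≡_; refl; cong₂)
open import Relation.Nullary.Decidable using (⌊_⌋)
open import Relation.Unary using (Pred; _∈_; _∩_; Empty)

data Letter : Set where
  a b z : Letter

Word : ℕ → Set
Word = Vec Letter

-- The Christoffel word C(n,s) over {c < z}, with t = n ∸ s.  It is meaningful
-- only when s ≤ n and gcd n s ≡ 1.  In the degenerate
-- case n = s = 1 (so t = 0) the formula yields the word z, not c.
christoffel : Letter → (n : ℕ) .{{_ : NonZero n}} → ℕ → Word n
christoffel c n s = tabulate λ i →
  if ⌊ (suc (toℕ i) * t) % n >? (toℕ i * t) % n ⌋ then c else z
  where
  t : ℕ
  t = n ∸ s

private
  variable
    ℓ : ℕ

γ : Word ℓ → Word ℓ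
γ []      = []
γ (c ∷ w) = w ∷ʳ c

γ⁻¹ : Word ℓ → Word ℓ
γ⁻¹ []        = []
γ⁻¹ w@(_ ∷ _) = last w ∷ init w

γ⁻¹∘γ : (w : Word ℓ) → γ⁻¹ (γ w) ≡ w
γ⁻¹∘γ []          = refl
γ⁻¹∘γ (c ∷ [])    = refl
γ⁻¹∘γ (c ∷ d ∷ w) = cong₂ _∷_ (last-∷ʳ c (d ∷ w)) (init-∷ʳ c (d ∷ w))

infixr 8 γ^_·_

γ^_·_ : ℤ → Word ℓ → Word ℓ
γ^ + k      · w = fold w γ k
γ^ -[1+ k ] · w = fold w γ⁻¹ (suc k)

positions : Letter → Word ℓ → Pred ℤ 0ℓ
positions {ℓ} c w x = ∃[ i ] (x ≡ + toℕ {ℓ} i × lookup w i ≡ c)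

infixl 6 _+_ℤ _-_

_+_ℤ : Pred ℤ 0ℓ → ℕ → Pred ℤ 0ℓ
(P + n ℤ) x = ∃[ y ] ∃[ j ] (y ∈ P × x ≡ y ℤ.+ + n ℤ.* j)

-- The translate { y - k | y ∈ P }.
_-_ : Pred ℤ 0ℓ → ℤ → Pred ℤ 0ℓ
(P - k) x = ∃[ y ] (y ∈ P × x ≡ y ℤ.- k)

-- Both notions below are for u over {a, z} and v over {b, z}.

PerfectlySuperimposable : ∀ {n m} → Word n → Word m → Set
PerfectlySuperimposable {n} {m} u v =
  Empty ((positions a u + n ℤ) ∩ (positions b v + m ℤ))

Superimposable : ∀ {n m} → Word n → Word m → Set
Superimposable {n} {m} u v =
  ∃[ k ] Empty ((positions a u + n ℤ) ∩ (positions b v - k + m ℤ))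

instance
  gcd-nonZero : ∀ {m n} .{{_ : NonZero m}} → NonZero (gcd m n)
  gcd-nonZero {m} {n} = ≢-nonZero (gcd[m,n]≢0 m n (inj₁ (≢-nonZero⁻¹ m)))

{-# OPTIONS --safe #-}

-- For s < n, the letter c of C(n,s) occurs at the residues x with x s ≡ -j (mod n), 0 ≤ j < s.
-- By the Chinese remainder theorem everything happens modulo p = gcd(m,n); multiplying by the
-- unit -qαβ, superimposability says that some class K + pℤ misses the set
-- D = { jβ - kα : 0 ≤ j < qα, 0 ≤ k < qβ }, and the conclusion says that the class of
-- α + (q-1)αβ misses D.  The integers outside D are exactly the (q-1)αβ + xβ + yα with x ≥ 0,
-- y ≥ 1 and the -((q-1)αβ + xβ + yα) with x ≥ 1, y ≥ 0.  In K + pℤ the largest negative and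
-- the least non-negative element are of opposite kinds, so their difference has the form
-- p = 2(q-1)αβ + Xβ + Yα with X, Y ≥ 1; for such p every α + (q-1)αβ + tp is outside D.

module Submission where

open import Data.Bool.Base using (if_then_else_)
open import Data.Fin.Base using (Fin; zero; suc; toℕ; fromℕ; inject₁; opposite; fromℕ<)
import Data.Fin.Properties as Fin
open import Data.Fin.Relation.Unary.Top using (view; ‵fromℕ; ‵inject₁)
open import Data.Integer.Base as ℤ
  using (ℤ; +_; -[1+_]; 0ℤ; 1ℤ; -_; _+_; _-_; _*_)
open import Data.Integer.Divisibility as ℤ using ()
open import Data.Integer.Divisibility.Signed as ℤˢ using (_∣_; divides)
import Data.Integer.DivMod as ℤ
import Data.Integer.Properties as ℤ
open import Data.Integer.Tactic.RingSolver using (solve-∀)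
open import Data.Nat.Base as ℕ using (ℕ; zero; suc; _≤_; _<_; _∸_; NonZero)
open import Data.Nat.Coprimality as ℕ using (Coprime)
import Data.Nat.Divisibility as ℕ
open import Data.Nat.DivMod as ℕ using (_%_; _/_)
open import Data.Nat.GCD using (gcd; gcd-GCD; gcd[m,n]∣m; gcd[m,n]∣n; module Bézout)
import Data.Nat.Properties as ℕ
open import Data.Product.Base using (_,_; _×_; ∃₂; ∃-syntax)
open import Data.Sum.Base using (_⊎_; inj₁; inj₂)
open import Data.Vec.Base using (Vec; []; _∷_; _∷ʳ_; init; last; lookup; reverse)
open import Data.Vec.Properties using (reverse-∷; lookup∘tabulate)
open import Relation.Binary.PropositionalEquality
open import Relation.Nullary using (¬_; Dec; yes; no; contradiction)
open import Relation.Nullary.Decidable using (⌊_⌋)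
open import Defs hiding (_-_)

-- Differences jβ - kα

bézout : ∀ m n → ∃₂ λ u v → + gcd m n ≡ u * + m + v * + n
bézout m n with Bézout.identity (gcd-GCD m n)
... | Bézout.+- x y eq = + x , - + y ,
  (begin
    + gcd m n                              ≡⟨ shuffle (+ gcd m n) (+ y) (+ n) ⟩
    (+ gcd m n + + y * + n) + - + y * + n  ≡⟨ cong (λ e → + gcd m n + e + - + y * + n) (sym (ℤ.pos-* y n)) ⟩
    + (gcd m n ℕ.+ y ℕ.* n) + - + y * + n  ≡⟨ cong (λ e → + e + - + y * + n) eq ⟩
    + (x ℕ.* m) + - + y * + n              ≡⟨ cong (_+ - + y * + n) (ℤ.pos-* x m) ⟩
    + x * + m + - + y * + n                ∎)
  where
  open ≡-Reasoning
  shuffle : ∀ g y n → g ≡ (g + y * n) + - y * n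
  shuffle = solve-∀
... | Bézout.-+ x y eq = - + x , + y ,
  (begin
    + gcd m n                              ≡⟨ shuffle (+ gcd m n) (+ x) (+ m) ⟩
    - + x * + m + (+ gcd m n + + x * + m)  ≡⟨ cong (λ e → - + x * + m + (+ gcd m n + e)) (sym (ℤ.pos-* x m)) ⟩
    - + x * + m + + (gcd m n ℕ.+ x ℕ.* m)  ≡⟨ cong (λ e → - + x * + m + + e) eq ⟩
    - + x * + m + + (y ℕ.* n)              ≡⟨ cong (λ e → - + x * + m + e) (ℤ.pos-* y n) ⟩
    - + x * + m + + y * + n                ∎)
  where
  open ≡-Reasoning
  shuffle : ∀ g x m → g ≡ - x * m + (g + x * m)
  shuffle = solve-∀

Difference : (q α β : ℕ) → ℤ → Set
Difference q α β c =
  ∃₂ λ j k → j < q ℕ.* α × k < q ℕ.* β × c ≡ + j * + β - + k * + α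

-- The integers outside Difference (suc q) α β are the gap q α β x y and the - gap q β α y x:
-- the multiplier here is one less than that of Difference.
gap : (q α β x y : ℕ) → ℤ
gap q α β x y = + q * (+ α * + β) + + x * + β + + suc y * + α

-- Moving `k α` to the right gives `j β = x β + α w` with `w = q β + (y + 1) + k`. Coprimality makes
-- `β` divide `w`, and a multiple of `β` above `q β` is at least `(q + 1) β`. So `j β` reaches
-- `(q + 1) α β`, against the bound on `j`.
gap-nonDifference : ∀ {q α β j k x y} .{{_ : NonZero β}} → Coprime α β →
  j < suc q ℕ.* α → + j * + β - + k * + α ≢ gap q α β x y
gap-nonDifference {q} {α} {β} {j} {k} {x} {y} α⊥β j<qα eq =
  contradiction (ℕ.*-cancelʳ-≤ (suc q ℕ.* α) j β qαβ≤jβ) (ℕ.<⇒≱ j<qα)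
  where
  open ≡-Reasoning
  w : ℕ
  w = q ℕ.* β ℕ.+ suc y ℕ.+ k

  regroup : ∀ j k q α β x y →
    (j * β - k * α ≡ q * (α * β) + x * β + y * α) → j * β ≡ x * β + α * (q * β + y + k)
  regroup j k q α β x y eq = begin
    j * β                                      ≡⟨ lem₁ (j * β) (k * α) ⟩
    (j * β - k * α) + k * α                    ≡⟨ cong (_+ k * α) eq ⟩
    q * (α * β) + x * β + y * α + k * α        ≡⟨ lem₂ k q α β x y ⟩
    x * β + α * (q * β + y + k)                ∎
    where
    lem₁ : ∀ u v → u ≡ u - v + v
    lem₁ = solve-∀
    lem₂ : ∀ k q α β x y →
      q * (α * β) + x * β + y * α + k * α ≡ x * β + α * (q * β + y + k)
    lem₂ = solve-∀

  jβ≡ : j ℕ.* β ≡ x ℕ.* β ℕ.+ α ℕ.* w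
  jβ≡ = ℤ.+-injective (begin
    + (j ℕ.* β)                                       ≡⟨ ℤ.pos-* j β ⟩
    + j * + β                                         ≡⟨ regroup (+ j) (+ k) (+ q) (+ α) (+ β) (+ x) (+ suc y) eq ⟩
    + x * + β + + α * (+ q * + β + + suc y + + k)     ≡⟨ cong (λ e → + x * + β + + α * (e + + suc y + + k)) (ℤ.pos-* q β) ⟨
    + x * + β + + α * + w                             ≡⟨ cong₂ _+_ (ℤ.pos-* x β) (ℤ.pos-* α w) ⟨
    + (x ℕ.* β ℕ.+ α ℕ.* w)                           ∎)

  β∣w : β ℕ.∣ w
  β∣w = ℕ.coprime-divisor (ℕ.sym α⊥β)
    (ℕ.∣m+n∣m⇒∣n (subst (β ℕ.∣_) jβ≡ (ℕ.n∣m*n j)) (ℕ.n∣m*n x))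

  qβ≤w : suc q ℕ.* β ≤ w
  qβ≤w with β∣w
  ... | ℕ.divides e w≡eβ = subst (suc q ℕ.* β ≤_) (sym w≡eβ)
    (ℕ.*-monoˡ-≤ β (ℕ.*-cancelʳ-< β q e (subst (q ℕ.* β <_) w≡eβ
      (ℕ.<-≤-trans (ℕ.m<m+n (q ℕ.* β) ℕ.z<s) (ℕ.m≤m+n _ k)))))

  qαβ≤jβ : suc q ℕ.* α ℕ.* β ≤ j ℕ.* β
  qαβ≤jβ = subst₂ _≤_ (trans (cong (α ℕ.*_) (ℕ.*-comm (suc q) β))
       (trans (sym (ℕ.*-assoc α β (suc q))) (trans (ℕ.*-comm (α ℕ.* β) (suc q)) (sym (ℕ.*-assoc (suc q) α β)))))
    (sym jβ≡) (ℕ.≤-trans (ℕ.*-monoʳ-≤ α qβ≤w) (ℕ.m≤n+m _ _))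

-- Exchanging `α`, `j`, `x` with `β`, `k`, `y` negates `j β - k α`, which reduces this to
-- `gap-nonDifference` with the bound on `k` in place of that on `j`.
-gap-nonDifference : ∀ {q α β j k x y} .{{_ : NonZero α}} → Coprime α β →
  k < suc q ℕ.* β → + j * + β - + k * + α ≢ - gap q β α y x
-gap-nonDifference {q} {α} {β} {j} {k} {x} {y} α⊥β k<qβ eq =
  gap-nonDifference {q} {β} {α} {k} {j} {y} {x} (ℕ.sym α⊥β) k<qβ
    (trans (swap (+ k * + α) (+ j * + β)) (trans (cong -_ eq) (ℤ.neg-involutive _)))
  where
  swap : ∀ u v → u - v ≡ - (v - u)
  swap = solve-∀

-- Bézout gives `c = x β + w α` with `0 ≤ x < α`. Every `w` with `-(q + 1) β < w ≤ q β` makes `c` a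
-- difference; a larger `w` makes it a gap, a smaller one the negative of a gap.
nonDifference-gap : ∀ q α β .{{_ : NonZero α}} .{{_ : NonZero β}} → gcd α β ≡ 1 → ∀ c →
  ¬ Difference (suc q) α β c →
  (∃₂ λ x y → c ≡ gap q α β x y) ⊎ (∃₂ λ x y → c ≡ - gap q β α y x)
nonDifference-gap q α β gcd≡1 c c∉D with bézout α β
... | u , v , 1≡ = go (c * u + d * + β) c≡
  where
  open ≡-Reasoning
  -- Only the remainder of `c v` by `α` stays as coefficient of `β`; the quotient `d` passes to the
  -- coefficient of `α` as `d β`.
  x : ℕ
  x = (c * v) ℤ.%ℕ α
  d : ℤ
  d = (c * v) ℤ./ℕ α

  x<α : x < α
  x<α = ℤ.n%ℕd<d (c * v) α

  c≡ : c ≡ + x * + β + (c * u + d * + β) * + α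
  c≡ = begin
    c                                         ≡⟨ ℤ.*-identityʳ c ⟨
    c * 1ℤ                                    ≡⟨ cong (λ g → c * + g) gcd≡1 ⟨
    c * + gcd α β                             ≡⟨ cong (c *_) 1≡ ⟩
    c * (u * + α + v * + β)                   ≡⟨ lem₁ c u v (+ α) (+ β) ⟩
    c * u * + α + (c * v) * + β               ≡⟨ cong (λ e → c * u * + α + e * + β) (ℤ.a≡a%ℕn+[a/ℕn]*n (c * v) α) ⟩
    c * u * + α + (+ x + d * + α) * + β       ≡⟨ lem₂ (c * u) (+ x) d (+ α) (+ β) ⟩
    + x * + β + (c * u + d * + β) * + α       ∎
    where
    lem₁ : ∀ c u v α β → c * (u * α + v * β) ≡ c * u * α + (c * v) * β
    lem₁ = solve-∀
    lem₂ : ∀ e x d α β → e * α + (x + d * α) * β ≡ x * β + (e + d * β) * α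
    lem₂ = solve-∀

  go : ∀ w → c ≡ + x * + β + w * + α →
    (∃₂ λ x y → c ≡ gap q α β x y) ⊎ (∃₂ λ x y → c ≡ - gap q β α y x)
  go (+ w) c≡ with w ℕ.≤? q ℕ.* β
  ... | yes w≤qβ with ℕ.m≤n⇒∃[o]m+o≡n w≤qβ
  ...   | k , qβ≡ = contradiction
          -- Adding and subtracting `q α β` leaves `-k` as the coefficient of `α`, where
          -- `k = q β - w`.
          (x ℕ.+ q ℕ.* α , k , ℕ.+-monoˡ-< (q ℕ.* α) x<α
          , ℕ.≤-<-trans (subst (k ≤_) qβ≡ (ℕ.m≤n+m k w)) (ℕ.m<n+m (q ℕ.* β) (ℕ.>-nonZero⁻¹ β))
          , (begin
            c                                              ≡⟨ c≡ ⟩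
            + x * + β + + w * + α                          ≡⟨ lem (+ x) (+ w) (+ k) (+ α) (+ β) ⟩
            + x * + β + (+ w + + k) * + α - + k * + α      ≡⟨ cong (λ e → + x * + β + e * + α - + k * + α) (trans (cong +_ qβ≡) (ℤ.pos-* q β)) ⟩
            + x * + β + (+ q * + β) * + α - + k * + α      ≡⟨ lem′ (+ x) (+ q) (+ k) (+ α) (+ β) ⟩
            (+ x + + q * + α) * + β - + k * + α            ≡⟨ cong (λ e → (+ x + e) * + β - + k * + α) (ℤ.pos-* q α) ⟨
            + (x ℕ.+ q ℕ.* α) * + β - + k * + α            ∎)) c∉D
          where
          lem : ∀ x w k α β → x * β + w * α ≡ x * β + (w + k) * α - k * α
          lem = solve-∀
          lem′ : ∀ x q k α β → x * β + (q * β) * α - k * α ≡ (x + q * α) * β - k * α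
          lem′ = solve-∀
  go (+ w) c≡ | no w≰qβ with ℕ.m≤n⇒∃[o]m+o≡n (ℕ.≰⇒> w≰qβ)
  ...   | y , w≡ = inj₁ (x , y , (begin
            c                                         ≡⟨ c≡ ⟩
            + x * + β + + w * + α                     ≡⟨ cong (λ e → + x * + β + + e * + α) w≡ ⟨
            + x * + β + (1ℤ + + (q ℕ.* β) + + y) * + α ≡⟨ cong (λ e → + x * + β + (1ℤ + e + + y) * + α) (ℤ.pos-* q β) ⟩
            + x * + β + (1ℤ + + q * + β + + y) * + α   ≡⟨ lem (+ x) (+ q) (+ y) (+ α) (+ β) ⟩
            gap q α β x y                              ∎))
          where
          lem : ∀ x q y α β →
            x * β + (1ℤ + q * β + y) * α ≡ q * (α * β) + x * β + (1ℤ + y) * α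
          lem = solve-∀
  go -[1+ w ] c≡ with suc w ℕ.<? suc q ℕ.* β
  ... | yes w<qβ = contradiction
          (x , suc w , ℕ.<-≤-trans x<α (ℕ.m≤m+n α _) , w<qβ
          , trans c≡ (cong (_+_ (+ x * + β)) (sym (ℤ.neg-distribˡ-* (+ suc w) (+ α))))) c∉D
  -- One `α β` is split off from `(q + 1) α β` and combined with `x β`: for `e = α - 1 - x` the
  -- result is `-(1 + e) β`.
  ... | no w≮qβ with ℕ.m≤n⇒∃[o]m+o≡n (ℕ.≮⇒≥ w≮qβ) | ℕ.m≤n⇒∃[o]m+o≡n x<α
  ...   | y , w≡ | e , α≡ = inj₂ (e , y , (begin
            c                                              ≡⟨ c≡ ⟩
            + x * + β + - (+ suc w) * + α                  ≡⟨ cong (λ t → + x * + β + - (+ t) * + α) w≡ ⟨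
            + x * + β + - (+ (suc q ℕ.* β) + + y) * + α    ≡⟨ cong (λ t → + x * + β + - (t + + y) * + α) (ℤ.pos-* (suc q) β) ⟩
            + x * + β + - ((1ℤ + + q) * + β + + y) * + α   ≡⟨ lem (+ x) (+ q) (+ y) (+ α) (+ β) ⟩
            + x * + β - + α * + β - (+ q * (+ β * + α) + + y * + α) ≡⟨ cong (λ t → + x * + β - + t * + β - (+ q * (+ β * + α) + + y * + α)) α≡ ⟨
            + x * + β - (1ℤ + + x + + e) * + β - (+ q * (+ β * + α) + + y * + α) ≡⟨ lem′ (+ x) (+ q) (+ y) (+ e) (+ α) (+ β) ⟩
            - gap q β α y e                                ∎))
          where
          lem : ∀ x q y α β →
            x * β + - ((1ℤ + q) * β + y) * α ≡ x * β - α * β - (q * (β * α) + y * α)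
          lem = solve-∀
          lem′ : ∀ x q y e α β → x * β - (1ℤ + x + e) * β - (q * (β * α) + y * α)
            ≡ - (q * (β * α) + y * α + (1ℤ + e) * β)
          lem′ = solve-∀

-- Residue classes modulo `p` that avoid the differences

gap-positive : ∀ q α β x y .{{_ : NonZero α}} → 0ℤ ℤ.< gap q α β x y
gap-positive q α β x y = subst (0ℤ ℤ.<_) cast
  (ℤ.+<+ (ℕ.<-≤-trans (ℕ.>-nonZero⁻¹ α) 
      (ℕ.≤-trans (ℕ.m≤m+n α (y ℕ.* α)) (ℕ.m≤n+m (suc y ℕ.* α) (q ℕ.* (α ℕ.* β) ℕ.+ x ℕ.* β)))))
  where
  open ≡-Reasoning
  cast : + (q ℕ.* (α ℕ.* β) ℕ.+ x ℕ.* β ℕ.+ suc y ℕ.* α) ≡ gap q α β x y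
  cast = cong₂ _+_
    (cong₂ _+_ (trans (ℤ.pos-* q (α ℕ.* β)) (cong (+ q *_) (ℤ.pos-* α β))) (ℤ.pos-* x β))
    (ℤ.pos-* (suc y) α)

-- Division of `K` by `p`, with quotient `d` and remainder `r`, supplies the neighbours `r ≥ 0` and
-- `r - p < 0` in the class of `K`. Gaps being positive, the first must be a gap and the second the
-- negative of one; subtracting them expresses `p`.
nonDifferences⇒period : ∀ q α β p .{{_ : NonZero α}} .{{_ : NonZero β}} .{{_ : NonZero p}} →
  gcd α β ≡ 1 → ∀ K → (∀ t → ¬ Difference (suc q) α β (K + t * + p)) →
  ∃₂ λ X Y → + p ≡ + 2 * (+ q * (+ α * + β)) + + suc X * + β + + suc Y * + α
nonDifferences⇒period q α β p gcd≡1 K K∉D =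
  combine (nonDifference-gap q α β gcd≡1 _ (K∉D (- d)))
          (nonDifference-gap q α β gcd≡1 _ (K∉D (- d - 1ℤ)))
  where
  open ≡-Reasoning
  d : ℤ
  d = K ℤ./ℕ p
  r : ℕ
  r = K ℤ.%ℕ p

  upper : K + (- d) * + p ≡ + r
  upper = begin
    K + (- d) * + p                     ≡⟨ cong (_+ (- d) * + p) (ℤ.a≡a%ℕn+[a/ℕn]*n K p) ⟩
    + r + d * + p + (- d) * + p         ≡⟨ lem (+ r) d (+ p) ⟩
    + r                                 ∎
    where
    lem : ∀ r d p → r + d * p + (- d) * p ≡ r
    lem = solve-∀

  step : ∀ K d p → (K + (- d) * p) - (K + (- d - 1ℤ) * p) ≡ p
  step = solve-∀

  step′ : ∀ K d p → K + (- d - 1ℤ) * p ≡ (K + (- d) * p) - p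
  step′ = solve-∀

  lower : K + (- d - 1ℤ) * + p ℤ.< 0ℤ
  lower = subst (ℤ._< 0ℤ) (sym (trans (step′ K d (+ p)) (cong (_- + p) upper)))
    (subst (+ r - + p ℤ.<_) (ℤ.+-inverseʳ (+ p))
      (ℤ.+-monoˡ-< (- + p) (ℤ.+<+ (ℤ.n%ℕd<d K p))))

  upper≥0 : 0ℤ ℤ.≤ K + (- d) * + p
  upper≥0 = subst (0ℤ ℤ.≤_) (sym upper) (ℤ.+≤+ ℕ.z≤n)

  combine :
    (∃₂ λ x y → K + (- d) * + p ≡ gap q α β x y) ⊎ (∃₂ λ x y → K + (- d) * + p ≡ - gap q β α y x) →
    (∃₂ λ x y → K + (- d - 1ℤ) * + p ≡ gap q α β x y) ⊎ (∃₂ λ x y → K + (- d - 1ℤ) * + p ≡ - gap q β α y x) →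
    ∃₂ λ X Y → + p ≡ + 2 * (+ q * (+ α * + β)) + + suc X * + β + + suc Y * + α
  combine (inj₂ (x , y , eq)) _ = contradiction (subst (0ℤ ℤ.≤_) eq upper≥0)
    (ℤ.<⇒≱ (ℤ.neg-mono-< {0ℤ} {gap q β α y x} (gap-positive q β α y x)))
  combine _ (inj₁ (x , y , eq)) = contradiction (subst (ℤ._< 0ℤ) eq lower)
    (ℤ.<-asym {0ℤ} {gap q α β x y} (gap-positive q α β x y))
  combine (inj₁ (x , y , eq)) (inj₂ (x′ , y′ , eq′)) = x ℕ.+ x′ , y ℕ.+ y′ , (begin
    + p                                       ≡⟨ step K d (+ p) ⟨
    (K + (- d) * + p) - (K + (- d - 1ℤ) * + p) ≡⟨ cong₂ _-_ eq eq′ ⟩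
    gap q α β x y - - gap q β α y′ x′         ≡⟨ lem (+ q) (+ α) (+ β) (+ x) (+ y) (+ x′) (+ y′) ⟩
    + 2 * (+ q * (+ α * + β)) + + suc (x ℕ.+ x′) * + β + + suc (y ℕ.+ y′) * + α ∎)
    where
    lem : ∀ q α β x y x′ y′ →
      (q * (α * β) + x * β + (1ℤ + y) * α) - - (q * (β * α) + y′ * α + (1ℤ + x′) * β) ≡
      + 2 * (q * (α * β)) + (1ℤ + (x + x′)) * β + (1ℤ + (y + y′)) * α
    lem = solve-∀

-- The representative `α + q α β` is the gap with `x = y = 0`, and adding copies of `p` only
-- enlarges its coefficients. Subtracting one copy turns `q α β` into `-q α β` thanks to the factor
-- 2, cancels the summand `α`, and still leaves a negative multiple of `β`: the negative of a gap.
-- Further copies keep this form.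
period⇒nonDifference : ∀ q α β p X Y .{{_ : NonZero α}} .{{_ : NonZero β}} → gcd α β ≡ 1 →
  + p ≡ + 2 * (+ q * (+ α * + β)) + + suc X * + β + + suc Y * + α →
  ∀ t → ¬ Difference (suc q) α β (+ α + + q * (+ α * + β) + t * + p)
period⇒nonDifference q α β p X Y gcd≡1 p≡ (+ t) (j , k , j<qα , _ , eq) =
  gap-nonDifference {q} {α} {β} {j} {k} {t ℕ.* suc X} {t ℕ.* (2 ℕ.* q ℕ.* β) ℕ.+ t ℕ.* suc Y}
    (ℕ.gcd≡1⇒coprime gcd≡1) j<qα (begin
      + j * + β - + k * + α
        ≡⟨ eq ⟨
      + α + + q * (+ α * + β) + + t * + p
        ≡⟨ cong (λ e → + α + + q * (+ α * + β) + + t * e) p≡ ⟩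
      + α + + q * (+ α * + β) + + t * (+ 2 * (+ q * (+ α * + β)) + + suc X * + β + + suc Y * + α)
        ≡⟨ lem (+ q) (+ α) (+ β) (+ t) (+ suc X) (+ suc Y) ⟩
      + q * (+ α * + β) + + t * + suc X * + β + (1ℤ + (+ t * (+ 2 * + q * + β) + + t * + suc Y)) * + α
        ≡⟨ cong₂ (λ e f → + q * (+ α * + β) + e * + β + (1ℤ + f) * + α) (ℤ.pos-* t (suc X))
             (cong₂ _+_ (trans (ℤ.pos-* t _) (cong (+ t *_) (trans (ℤ.pos-* (2 ℕ.* q) β) (cong (_* + β) (ℤ.pos-* 2 q))))) (ℤ.pos-* t (suc Y))) ⟨
      gap q α β (t ℕ.* suc X) (t ℕ.* (2 ℕ.* q ℕ.* β) ℕ.+ t ℕ.* suc Y) ∎)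
  where
  open ≡-Reasoning
  lem : ∀ q α β t X Y → α + q * (α * β) + t * (+ 2 * (q * (α * β)) + X * β + Y * α) ≡
    q * (α * β) + t * X * β + (1ℤ + (t * (+ 2 * q * β) + t * Y)) * α
  lem = solve-∀
period⇒nonDifference q α β p X Y gcd≡1 p≡ -[1+ t ] (j , k , _ , k<qβ , eq) =
  -- The coefficient of `β` is `(t + 1) (X + 1)`, passed less one because `gap` takes a successor.
  -- That of `α` is `2 q β t + (t + 1) (Y + 1) - 1`, where the `- 1` is due to the summand `α`.
  -gap-nonDifference {q} {α} {β} {j} {k} {t ℕ.+ suc t ℕ.* X} {2 ℕ.* q ℕ.* β ℕ.* t ℕ.+ (t ℕ.+ suc t ℕ.* Y)}
    (ℕ.gcd≡1⇒coprime gcd≡1) k<qβ (begin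
      + j * + β - + k * + α
        ≡⟨ eq ⟨
      + α + + q * (+ α * + β) + - (+ suc t) * + p
        ≡⟨ cong (λ e → + α + + q * (+ α * + β) + - (+ suc t) * e) p≡ ⟩
      + α + + q * (+ α * + β) + - (+ suc t) * (+ 2 * (+ q * (+ α * + β)) + + suc X * + β + + suc Y * + α)
        ≡⟨ lem (+ q) (+ α) (+ β) (+ t) (+ X) (+ Y) ⟩
      - (+ q * (+ β * + α) + (+ 2 * + q * + β * + t + (+ t + + suc t * + Y)) * + α + (1ℤ + (+ t + + suc t * + X)) * + β)
        ≡⟨ cong₂ (λ e f → - (+ q * (+ β * + α) + e * + α + (1ℤ + (+ t + f)) * + β))
             (cong₂ (λ e f → e + (+ t + f)) (trans (ℤ.pos-* (2 ℕ.* q ℕ.* β) t) (cong (_* + t) (trans (ℤ.pos-* (2 ℕ.* q) β) (cong (_* + β) (ℤ.pos-* 2 q))))) (ℤ.pos-* (suc t) Y)) (ℤ.pos-* (suc t) X) ⟨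
      - gap q β α (2 ℕ.* q ℕ.* β ℕ.* t ℕ.+ (t ℕ.+ suc t ℕ.* Y)) (t ℕ.+ suc t ℕ.* X) ∎)
  where
  open ≡-Reasoning
  lem : ∀ q α β t X Y → α + q * (α * β) + - (1ℤ + t) * (+ 2 * (q * (α * β)) + (1ℤ + X) * β + (1ℤ + Y) * α) ≡
    - (q * (β * α) + (+ 2 * q * β * t + (t + (1ℤ + t) * Y)) * α + (1ℤ + (t + (1ℤ + t) * X)) * β)
  lem = solve-∀

-- Occurrences of letters in conjugates and reversals

lookup-∷ʳ-inject₁ : ∀ {A : Set} {ℓ} (w : Vec A ℓ) c i → lookup (w ∷ʳ c) (inject₁ i) ≡ lookup w i
lookup-∷ʳ-inject₁ (d ∷ w) c zero    = refl
lookup-∷ʳ-inject₁ (d ∷ w) c (suc i) = lookup-∷ʳ-inject₁ w c i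

lookup-∷ʳ-fromℕ : ∀ {A : Set} {ℓ} (w : Vec A ℓ) c → lookup (w ∷ʳ c) (fromℕ ℓ) ≡ c
lookup-∷ʳ-fromℕ []      c = refl
lookup-∷ʳ-fromℕ (d ∷ w) c = lookup-∷ʳ-fromℕ w c

lookup-init : ∀ {A : Set} {ℓ} (w : Vec A (suc ℓ)) i → lookup (init w) i ≡ lookup w (inject₁ i)
lookup-init (c ∷ d ∷ w) zero    = refl
lookup-init (c ∷ d ∷ w) (suc i) = lookup-init (d ∷ w) i

lookup-last : ∀ {A : Set} {ℓ} (w : Vec A (suc ℓ)) → last w ≡ lookup w (fromℕ ℓ)
lookup-last (c ∷ [])    = refl
lookup-last (c ∷ d ∷ w) = lookup-last (d ∷ w)

lookup-reverse : ∀ {A : Set} {ℓ} (w : Vec A ℓ) i → lookup (reverse w) i ≡ lookup w (opposite i)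
lookup-reverse (c ∷ w) i rewrite reverse-∷ c w with view i
... | ‵fromℕ      = trans (lookup-∷ʳ-fromℕ (reverse w) c)
                      (cong (lookup (c ∷ w)) (sym (opposite-fromℕ _)))
  where
  opposite-fromℕ : ∀ ℓ → opposite (fromℕ ℓ) ≡ zero
  opposite-fromℕ zero    = refl
  opposite-fromℕ (suc ℓ) = cong inject₁ (opposite-fromℕ ℓ)
... | ‵inject₁ i′ = trans (lookup-∷ʳ-inject₁ (reverse w) c i′)
                      (trans (lookup-reverse w i′) (cong (lookup (c ∷ w)) (sym (opposite-inject₁ i′))))
  where
  opposite-inject₁ : ∀ {ℓ} (i : Fin ℓ) → opposite (inject₁ i) ≡ suc (opposite i)
  opposite-inject₁ zero    = refl
  opposite-inject₁ (suc i) = cong inject₁ (opposite-inject₁ i)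

-- Positions in the bi-infinite periodic extension of `w`, where rotations act as translations of
-- the integers and reversal as a reflection.
Occurs : ∀ {ℓ} → Letter → Word ℓ → ℤ → Set
Occurs {ℓ} c w = _+_ℤ (positions c w) ℓ

Occurs-γ : ∀ {ℓ} c (w : Word ℓ) x → Occurs c (γ w) x → Occurs c w (x + 1ℤ)
Occurs-γ {suc ℓ} c (d ∷ w) x (_ , k , (i , refl , w[i]≡c) , x≡) with view i
-- The last letter of `γ w` is the first letter of `w` one period later.
... | ‵fromℕ = + 0 , k + 1ℤ , (zero , refl , trans (sym (lookup-∷ʳ-fromℕ w d)) w[i]≡c)
  , trans (cong (_+ 1ℤ) x≡) (trans (cong (λ i → + i + + suc ℓ * k + 1ℤ) (Fin.toℕ-fromℕ ℓ)) (lem (+ ℓ) k))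
  where
  lem : ∀ ℓ k → ℓ + (1ℤ + ℓ) * k + 1ℤ ≡ + 0 + (1ℤ + ℓ) * (k + 1ℤ)
  lem = solve-∀
... | ‵inject₁ i′ = + suc (toℕ i′) , k , (suc i′ , refl , trans (sym (lookup-∷ʳ-inject₁ w d i′)) w[i]≡c)
  , trans (cong (_+ 1ℤ) x≡) (trans (cong (λ i → + i + + suc ℓ * k + 1ℤ) (Fin.toℕ-inject₁ i′)) (lem (+ toℕ i′) (+ suc ℓ) k))
  where
  lem : ∀ i ℓ k → i + ℓ * k + 1ℤ ≡ (1ℤ + i) + ℓ * k
  lem = solve-∀

Occurs-γ⁻¹ : ∀ {ℓ} c (w : Word ℓ) x → Occurs c (γ⁻¹ w) x → Occurs c w (x - 1ℤ)
-- The first letter of `γ⁻¹ w` is the last letter of `w` one period earlier.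
Occurs-γ⁻¹ {suc ℓ} c w@(_ ∷ _) x (_ , k , (zero , refl , w[i]≡c) , x≡) =
  + toℕ (fromℕ ℓ) , k - 1ℤ , (fromℕ ℓ , refl , trans (sym (lookup-last w)) w[i]≡c)
  , trans (cong (_- 1ℤ) x≡) (trans (lem (+ ℓ) k) (cong (λ i → + i + + suc ℓ * (k - 1ℤ)) (sym (Fin.toℕ-fromℕ ℓ))))
  where
  lem : ∀ ℓ k → 0ℤ + (1ℤ + ℓ) * k - 1ℤ ≡ ℓ + (1ℤ + ℓ) * (k - 1ℤ)
  lem = solve-∀
Occurs-γ⁻¹ {suc ℓ} c w@(_ ∷ _) x (_ , k , (suc i , refl , w[i]≡c) , x≡) =
  + toℕ (inject₁ i) , k , (inject₁ i , refl , trans (sym (lookup-init w i)) w[i]≡c)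
  , trans (cong (_- 1ℤ) x≡) (trans (lem (+ toℕ i) (+ suc ℓ) k) (cong (λ i → + i + + suc ℓ * k) (sym (Fin.toℕ-inject₁ i))))
  where
  lem : ∀ i ℓ k → 1ℤ + i + ℓ * k - 1ℤ ≡ i + ℓ * k
  lem = solve-∀

Occurs-γ^ : ∀ {ℓ} c e (w : Word ℓ) x → Occurs c (γ^ e · w) x → Occurs c w (x + e)
Occurs-γ^ c (+ zero) w x occ = subst (Occurs c w) (sym (ℤ.+-identityʳ x)) occ
Occurs-γ^ c (+ suc e) w x occ = subst (Occurs c w) (ℤ.+-assoc x 1ℤ (+ e))
  (Occurs-γ^ c (+ e) w (x + 1ℤ) (Occurs-γ c (γ^ + e · w) x occ))
Occurs-γ^ c -[1+ zero ] w x occ = Occurs-γ⁻¹ c w x occ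
Occurs-γ^ c -[1+ suc e ] w x occ = subst (Occurs c w) (ℤ.+-assoc x -[1+ 0 ] -[1+ e ])
  (Occurs-γ^ c -[1+ e ] w (x - 1ℤ) (Occurs-γ⁻¹ c (γ^ -[1+ e ] · w) x occ))

-- Reversal sends position `i` to `ℓ - 1 - i`, which is congruent to `-1 - i` modulo `ℓ`.
Occurs-reverse : ∀ {ℓ} c (w : Word ℓ) x → Occurs c (reverse w) x → Occurs c w (- 1ℤ - x)
Occurs-reverse {ℓ} c w x (_ , k , (i , refl , w[i]≡c) , x≡) =
  + toℕ (opposite i) , - k - 1ℤ , (opposite i , refl , trans (sym (lookup-reverse w i)) w[i]≡c) , (begin
    - 1ℤ - x                                        ≡⟨ cong (λ x → - 1ℤ - x) x≡ ⟩
    - 1ℤ - (+ toℕ i + + ℓ * k)                      ≡⟨ lem (+ ℓ) k (+ toℕ i) (+ toℕ (opposite i)) ⟩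
    + toℕ (opposite i) + (+ ℓ - (+ toℕ (opposite i) + (1ℤ + + toℕ i)))  + + ℓ * (- k - 1ℤ)
      ≡⟨ cong (λ e → + toℕ (opposite i) + (+ ℓ - + e) + + ℓ * (- k - 1ℤ)) sum ⟩
    + toℕ (opposite i) + (+ ℓ - + ℓ) + + ℓ * (- k - 1ℤ)
      ≡⟨ lem′ (+ ℓ) k (+ toℕ (opposite i)) ⟩
    + toℕ (opposite i) + + ℓ * (- k - 1ℤ)           ∎)
  where
  open ≡-Reasoning
  sum : toℕ (opposite i) ℕ.+ suc (toℕ i) ≡ ℓ
  sum = trans (cong (ℕ._+ suc (toℕ i)) (Fin.opposite-prop i)) (ℕ.m∸n+n≡m (Fin.toℕ<n i))
  lem : ∀ ℓ k i o → - 1ℤ - (i + ℓ * k) ≡ o + (ℓ - (o + (1ℤ + i))) + ℓ * (- k - 1ℤ)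
  lem = solve-∀
  lem′ : ∀ ℓ k o → o + (ℓ - ℓ) + ℓ * (- k - 1ℤ) ≡ o + ℓ * (- k - 1ℤ)
  lem′ = solve-∀

-- Residues of the letters of a Christoffel word

∣-⇒≡ : ∀ {n i j} → i < n → j < n → + n ∣ + i - + j → i ≡ j
∣-⇒≡ {n} {i} {j} i<n j<n n∣i-j = ℤ.+-injective (ℤ.i-j≡0⇒i≡j (+ i) (+ j)
  (ℤ.∣i∣≡0⇒i≡0 (small (ℤˢ.∣⇒∣ᵤ n∣i-j) (subst (λ d → ℤ.∣ d ∣ < n) (sym (ℤ.m-n≡m⊖n i j))
    (ℕ.≤-<-trans (ℤ.∣m⊝n∣≤m⊔n i j) (ℕ.⊔-pres-<m i<n j<n))))))
  where
  small : ∀ {d} → n ℕ.∣ d → d < n → d ≡ 0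
  small {zero}  _   _   = refl
  small {suc d} n∣d d<n = contradiction n∣d (ℕ.>⇒∤ d<n)

if-yes : ∀ {P : Set} {c d : Letter} → c ≢ d → (P? : Dec P) → (if ⌊ P? ⌋ then c else d) ≡ c → P
if-yes c≢d (yes p) _  = p
if-yes c≢d (no _)  eq = contradiction (sym eq) c≢d

yes-if : ∀ {P : Set} {c d : Letter} → (P? : Dec P) → P → (if ⌊ P? ⌋ then c else d) ≡ c
yes-if (yes _) _ = refl
yes-if (no ¬p) p = contradiction p ¬p

module _ (n : ℕ) .{{_ : NonZero n}} (s : ℕ) (s≤n : s ≤ n) where

  private
    t = n ∸ s
    s+t≡n : s ℕ.+ t ≡ n
    s+t≡n = ℕ.m+[n∸m]≡n s≤n

  +-%ˡ : ∀ k → (t ℕ.+ k) % n ≡ (t ℕ.+ k % n) % n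
  +-%ˡ k = begin
    (t ℕ.+ k) % n                               ≡⟨ cong (λ e → (t ℕ.+ e) % n) (ℕ.m≡m%n+[m/n]*n k n) ⟩
    (t ℕ.+ (k % n ℕ.+ k ℕ./ n ℕ.* n)) % n       ≡⟨ cong (_% n) (ℕ.+-assoc t (k % n) _) ⟨
    (t ℕ.+ k % n ℕ.+ k ℕ./ n ℕ.* n) % n         ≡⟨ ℕ.[m+kn]%n≡m%n (t ℕ.+ k % n) (k ℕ./ n) n ⟩
    (t ℕ.+ k % n) % n                           ∎
    where open ≡-Reasoning

  -- Let `ρ` be the residue of `k`. If `ρ < s`, the strict rise gives `ρ < t + ρ`, hence `t > 0`. If
  -- `ρ = s + o`, then `t + ρ = n + o` wraps round to at most `o ≤ ρ`, which is no rise.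
  rises⇒ : ∀ k → k % n < (t ℕ.+ k) % n → k % n < s × s < n
  rises⇒ k rises with k % n ℕ.<? s
  ... | yes ρ<s = ρ<s , subst (s <_) s+t≡n (ℕ.m<m+n s (ℕ.+-cancelʳ-< (k % n) 0 t
    (ℕ.<-≤-trans (subst (k % n <_) (+-%ˡ k) rises) (ℕ.m%n≤m (t ℕ.+ k % n) n))))
  ... | no ρ≮s with ℕ.m≤n⇒∃[o]m+o≡n (ℕ.≮⇒≥ ρ≮s)
  ...   | o , s+o≡ρ = contradiction rises (ℕ.≤⇒≯ (begin
    (t ℕ.+ k) % n           ≡⟨ +-%ˡ k ⟩
    (t ℕ.+ k % n) % n       ≡⟨ cong (λ e → (t ℕ.+ e) % n) s+o≡ρ ⟨
    (t ℕ.+ (s ℕ.+ o)) % n   ≡⟨ cong (_% n) (trans (sym (ℕ.+-assoc t s o)) (cong (ℕ._+ o) (trans (ℕ.+-comm t s) s+t≡n))) ⟩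
    (n ℕ.+ o) % n           ≡⟨ cong (_% n) (ℕ.+-comm n o) ⟩
    (o ℕ.+ n) % n           ≡⟨ ℕ.[m+n]%n≡m%n o n ⟩
    o % n                   ≤⟨ ℕ.m%n≤m o n ⟩
    o                       ≤⟨ ℕ.m≤n+m o s ⟩
    s ℕ.+ o                 ≡⟨ s+o≡ρ ⟩
    k % n                   ∎))
    where open ℕ.≤-Reasoning

  rises⇐ : ∀ k → k % n < s → s < n → k % n < (t ℕ.+ k) % n
  rises⇐ k ρ<s s<n = subst (k % n <_)
    (sym (trans (+-%ˡ k) (ℕ.m<n⇒m%n≡m (subst (t ℕ.+ k % n <_) (trans (ℕ.+-comm t s) s+t≡n) (ℕ.+-monoʳ-< t ρ<s)))))
    (ℕ.m<n+m (k % n) (ℕ.m<n⇒0<n∸m s<n))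

  private
    it≡ : ∀ i → + i * + t ≡ + ((i ℕ.* t) % n) + + (i ℕ.* t ℕ./ n) * + n
    it≡ i = trans (sym (ℤ.pos-* i t)) (trans (cong +_ (ℕ.m≡m%n+[m/n]*n (i ℕ.* t) n))
      (cong (_+_ (+ ((i ℕ.* t) % n))) (ℤ.pos-* (i ℕ.* t ℕ./ n) n)))

  -- The witness `j` is the residue `ρ` of `i t`: modulo `n`, `x s + ρ` is `i s + i t = i n`.
  christoffel⇒ : ∀ {c} → c ≢ z → ∀ x → Occurs c (christoffel c n s) x →
    s < n × ∃[ j ] (j < s × + n ∣ x * + s + + j)
  christoffel⇒ {c} c≢z x (_ , k , (i , refl , w[i]≡c) , x≡)
    with rises⇒ (toℕ i ℕ.* t) (if-yes c≢z (_ ℕ.>? _) (trans (sym (lookup∘tabulate _ i)) w[i]≡c))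
  ... | ρ<s , s<n = s<n , _ , ρ<s , divides (+ toℕ i + k * + s - + d) (begin
    x * + s + + ρ                                          ≡⟨ cong (λ x → x * + s + + ρ) x≡ ⟩
    (+ toℕ i + + n * k) * + s + + ρ                        ≡⟨ lem (+ n) (+ s) (+ toℕ i) (+ ρ) (+ d) k ⟩
    + toℕ i * + s + (+ ρ + + d * + n) + (k * + s - + d) * + n ≡⟨ cong (λ e → + toℕ i * + s + e + (k * + s - + d) * + n) (it≡ (toℕ i)) ⟨
    + toℕ i * + s + + toℕ i * + t + (k * + s - + d) * + n  ≡⟨ cong (_+ (k * + s - + d) * + n) (ℤ.*-distribˡ-+ (+ toℕ i) (+ s) (+ t)) ⟨
    + toℕ i * + (s ℕ.+ t) + (k * + s - + d) * + n          ≡⟨ cong (λ e → + toℕ i * + e + (k * + s - + d) * + n) s+t≡n ⟩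
    + toℕ i * + n + (k * + s - + d) * + n                  ≡⟨ lem′ (+ n) (+ s) (+ toℕ i) (+ d) k ⟩
    (+ toℕ i + k * + s - + d) * + n                        ∎)
    where
    open ≡-Reasoning
    ρ d : ℕ
    ρ = (toℕ i ℕ.* t) % n
    d = toℕ i ℕ.* t ℕ./ n
    lem : ∀ n s i ρ d k → (i + n * k) * s + ρ ≡ i * s + (ρ + d * n) + (k * s - d) * n
    lem = solve-∀
    lem′ : ∀ n s i d k → i * n + (k * s - d) * n ≡ (i + k * s - d) * n
    lem′ = solve-∀

  -- For `i` the residue of `x`, both `j` and the residue `ρ` of `i t` are congruent to `-x s`
  -- modulo `n`. Both lie below `n`, so `ρ = j < s` and the sequence rises at `i`.
  christoffel⇐ : ∀ {c} → s < n → ∀ x j → j < s → + n ∣ x * + s + + j →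
    Occurs c (christoffel c n s) x
  christoffel⇐ {c} s<n x j j<s (divides e xs+j≡en) =
    + toℕ i , d , (i , refl , trans (lookup∘tabulate _ i) (yes-if (_ ℕ.>? _) (rises⇐ (toℕ i ℕ.* t) ρ<s s<n))) , x≡
    where
    open ≡-Reasoning
    d : ℤ
    d = x ℤ./ℕ n
    i : Fin n
    i = fromℕ< (ℤ.n%ℕd<d x n)
    ρ f : ℕ
    ρ = (toℕ i ℕ.* t) % n
    f = toℕ i ℕ.* t ℕ./ n
    x≡ : x ≡ + toℕ i + + n * d
    x≡ = trans (ℤ.a≡a%ℕn+[a/ℕn]*n x n)
      (cong₂ _+_ (cong +_ (sym (Fin.toℕ-fromℕ< (ℤ.n%ℕd<d x n)))) (ℤ.*-comm d (+ n)))
    n∣ρ-j : + n ∣ + ρ - + j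
    n∣ρ-j = divides (+ toℕ i - + f - e + d * + s) (begin
      + ρ - + j
        ≡⟨ lem (+ ρ) (+ f) (+ n) (+ j) (x * + s) ⟩
      (+ ρ + + f * + n) - + f * + n - (x * + s + + j) + x * + s
        ≡⟨ cong₂ (λ g h → g - + f * + n - h + x * + s) (sym (it≡ (toℕ i))) xs+j≡en ⟩
      + toℕ i * + t - + f * + n - e * + n + x * + s
        ≡⟨ cong (λ x → + toℕ i * + t - + f * + n - e * + n + x * + s) x≡ ⟩
      + toℕ i * + t - + f * + n - e * + n + (+ toℕ i + + n * d) * + s
        ≡⟨ lem′ (+ toℕ i) (+ t) (+ f) (+ n) e d (+ s) ⟩
      + toℕ i * + (s ℕ.+ t) + (d * + s - + f - e) * + n
        ≡⟨ cong (λ g → + toℕ i * + g + (d * + s - + f - e) * + n) s+t≡n ⟩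
      + toℕ i * + n + (d * + s - + f - e) * + n
        ≡⟨ lem″ (+ toℕ i) (+ n) (d * + s) (+ f) e ⟩
      (+ toℕ i - + f - e + d * + s) * + n ∎)
      where
      lem : ∀ ρ f n j y → ρ - j ≡ (ρ + f * n) - f * n - (y + j) + y
      lem = solve-∀
      lem′ : ∀ i t f n e d s → i * t - f * n - e * n + (i + n * d) * s ≡ i * (s + t) + (d * s - f - e) * n
      lem′ = solve-∀
      lem″ : ∀ i n y f e → i * n + (y - f - e) * n ≡ (i - f - e + y) * n
      lem″ = solve-∀
    ρ<s : ρ < s
    ρ<s = subst (_< s) (sym (∣-⇒≡ (ℕ.m%n<n _ n) (ℕ.<-trans j<s s<n) n∣ρ-j)) j<s

-- Reduction modulo gcd m n

+gcd∣+m : ∀ m n → + gcd m n ∣ + m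
+gcd∣+m m n = ℤˢ.∣ᵤ⇒∣ (gcd[m,n]∣m m n)

+gcd∣+n : ∀ m n → + gcd m n ∣ + n
+gcd∣+n m n = ℤˢ.∣ᵤ⇒∣ (gcd[m,n]∣n m n)

crt : ∀ m n y₁ y₂ → + gcd m n ∣ y₂ - y₁ → ∃[ x ] (+ n ∣ x - y₁ × + m ∣ x - y₂)
crt m n y₁ y₂ (divides d y₂-y₁≡) with bézout m n
-- The added term vanishes modulo `n`; since `y₂ - y₁ = d (u m + v n)`, the distance to `y₂` is
-- `-d u m`.
... | u , v , p≡ = y₁ + d * v * + n
  , divides (d * v) (lem₁ y₁ (d * v * + n))
  , divides (- d * u) (begin
      y₁ + d * v * + n - y₂                     ≡⟨ lem₂ y₁ y₂ (d * v * + n) ⟩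
      d * v * + n - (y₂ - y₁)                   ≡⟨ cong (λ e → d * v * + n - e) (trans y₂-y₁≡ (cong (d *_) p≡)) ⟩
      d * v * + n - d * (u * + m + v * + n)     ≡⟨ lem₃ d u v (+ m) (+ n) ⟩
      - d * u * + m                             ∎)
  where
  open ≡-Reasoning
  lem₁ : ∀ y e → y + e - y ≡ e
  lem₁ = solve-∀
  lem₂ : ∀ y₁ y₂ e → y₁ + e - y₂ ≡ e - (y₂ - y₁)
  lem₂ = solve-∀
  lem₃ : ∀ d u v m n → d * v * n - d * (u * m + v * n) ≡ - d * u * m
  lem₃ = solve-∀

inverse : ∀ n s → gcd n s ≡ 1 → ∃[ S ] + n ∣ + s * S - 1ℤ
inverse n s gcd≡1 with bézout n s
... | u , v , 1≡ = v , divides (- u) (begin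
  + s * v - 1ℤ                  ≡⟨ cong (λ e → + s * v - e) (trans (cong +_ (sym gcd≡1)) 1≡) ⟩
  + s * v - (u * + n + v * + s) ≡⟨ lem (+ n) (+ s) u v ⟩
  - u * + n                     ∎)
  where
  open ≡-Reasoning
  lem : ∀ n s u v → s * v - (u * n + v * s) ≡ - u * n
  lem = solve-∀

∣-cancel : ∀ {p} s S e → p ∣ s * S - 1ℤ → p ∣ s * e → p ∣ e
∣-cancel {p} s S e p∣sS-1 p∣se = subst (p ∣_) (lem s S e)
  (ℤˢ.∣m∣n⇒∣m-n (ℤˢ.∣n⇒∣m*n S p∣se) (ℤˢ.∣m⇒∣m*n e p∣sS-1))
  where
  lem : ∀ s S e → S * (s * e) - (s * S - 1ℤ) * e ≡ e
  lem = solve-∀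

-- This is the solvability condition for `x ≡ -j S` modulo `n` and `x ≡ -k - j′ S′` modulo `m`.
-- Multiplied by the units `s` and `s′`, it becomes `q (j β - j′ α - k q α β) ≡ 0` modulo `p`.
difference⇒compatible : ∀ p s s′ S S′ q α β k j j′ t → s ≡ q * α → s′ ≡ q * β →
  p ∣ s * S - 1ℤ → p ∣ s′ * S′ - 1ℤ → k * q * α * β + t * p ≡ j * β - j′ * α →
  p ∣ (- k - j′ * S′) - - j * S
difference⇒compatible p s s′ S S′ q α β k j j′ t s≡ s′≡ p∣sS-1 p∣s′S′-1 eq =
  ∣-cancel s′ S′ _ p∣s′S′-1 (∣-cancel s S _ p∣sS-1 (subst (p ∣_) (sym (expand s s′ S S′ k j j′))
    (ℤˢ.∣m∣n⇒∣m+n (ℤˢ.∣m∣n⇒∣m-n (ℤˢ.∣m⇒∣m*n (s′ * j) p∣sS-1) (ℤˢ.∣m⇒∣m*n (s * j′) p∣s′S′-1))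
      (divides (q * t) remainder))))
  where
  open ≡-Reasoning
  expand : ∀ s s′ S S′ k j j′ → s * (s′ * ((- k - j′ * S′) - - j * S)) ≡
    (s * S - 1ℤ) * (s′ * j) - (s′ * S′ - 1ℤ) * (s * j′) + (s′ * j - s * j′ - s * s′ * k)
  expand = solve-∀
  lem₁ : ∀ q α β k j j′ → q * β * j - q * α * j′ - q * α * (q * β) * k ≡
    q * (j * β - j′ * α - k * q * α * β)
  lem₁ = solve-∀
  lem₂ : ∀ q t p u → q * (u + t * p - u) ≡ q * t * p
  lem₂ = solve-∀
  remainder : s′ * j - s * j′ - s * s′ * k ≡ q * t * p
  remainder = begin
    s′ * j - s * j′ - s * s′ * k                    ≡⟨ cong₂ (λ s s′ → s′ * j - s * j′ - s * s′ * k) s≡ s′≡ ⟩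
    q * β * j - q * α * j′ - q * α * (q * β) * k    ≡⟨ lem₁ q α β k j j′ ⟩
    q * (j * β - j′ * α - k * q * α * β)            ≡⟨ cong (λ e → q * (e - k * q * α * β)) eq ⟨
    q * (k * q * α * β + t * p - k * q * α * β)     ≡⟨ lem₂ q t p (k * q * α * β) ⟩
    q * t * p                                       ∎

∣-residue : ∀ {d} x s j S → d ∣ s * S - 1ℤ → d ∣ x - - j * S → d ∣ x * s + j
∣-residue {d} x s j S d∣sS-1 d∣x+jS = subst (d ∣_) (lem x s j S)
  (ℤˢ.∣m∣n⇒∣m-n (ℤˢ.∣m⇒∣m*n s d∣x+jS) (ℤˢ.∣n⇒∣m*n j d∣sS-1))
  where
  lem : ∀ x s j S → (x - - j * S) * s - j * (s * S - 1ℤ) ≡ x * s + j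
  lem = solve-∀

∣-translate : ∀ {d} x k j S → d ∣ x - (- k - j * S) → d ∣ x + k - - j * S
∣-translate {d} x k j S = subst (d ∣_) (lem x k j S)
  where
  lem : ∀ x k j S → x - (- k - j * S) ≡ x + k - - j * S
  lem = solve-∀

translate-back : ∀ x y u k → x + k ≡ y + u → x ≡ y - k + u
translate-back x y u k x+k≡ = trans (lem₁ x k) (trans (cong (_- k) x+k≡) (lem₂ y u k))
  where
  lem₁ : ∀ x k → x ≡ x + k - k
  lem₁ = solve-∀
  lem₂ : ∀ y u k → y + u - k ≡ y - k + u
  lem₂ = solve-∀

-- Common positions and differences

module _ (n m : ℕ) .{{_ : NonZero n}} .{{_ : NonZero m}} (q α β : ℕ)
  (qα≤n : q ℕ.* α ≤ n) (gcd[n,qα]≡1 : gcd n (q ℕ.* α) ≡ 1)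
  (qβ≤m : q ℕ.* β ≤ m) (gcd[m,qβ]≡1 : gcd m (q ℕ.* β) ≡ 1) where

  private
    p : ℕ
    p = gcd m n

  -- With `S` and `S′` inverse to `q α` and `q β`, a difference in the class of `k q α β` makes the
  -- congruences for an `a` at `x` and a `b` at `x + k` compatible. Their common solution `x` would
  -- violate disjointness for the shift `k`.
  superimposable⇒nonDifferences : q ℕ.* α < n → q ℕ.* β < m →
    Superimposable (christoffel a n (q ℕ.* α)) (christoffel b m (q ℕ.* β)) →
    ∃[ K ] (∀ t → ¬ Difference q α β (K + t * + p))
  superimposable⇒nonDifferences qα<n qβ<m (k , disjoint) = k * + q * + α * + β , excluded
    where
    excluded : ∀ t → ¬ Difference q α β (k * + q * + α * + β + t * + p)
    excluded t (j , j′ , j<qα , j′<qβ , eq) =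
      let S , n∣ = inverse n (q ℕ.* α) gcd[n,qα]≡1
          S′ , m∣ = inverse m (q ℕ.* β) gcd[m,qβ]≡1
          x , n∣x , m∣x = crt m n (- + j * S) (- k - + j′ * S′)
            (difference⇒compatible (+ p) (+ (q ℕ.* α)) (+ (q ℕ.* β)) S S′ (+ q) (+ α) (+ β) k (+ j) (+ j′) t
              (ℤ.pos-* q α) (ℤ.pos-* q β) (ℤˢ.∣-trans (+gcd∣+n m n) n∣) (ℤˢ.∣-trans (+gcd∣+m m n) m∣) eq)
          x∈A = christoffel⇐ n (q ℕ.* α) qα≤n qα<n x j j<qα
            (∣-residue x (+ (q ℕ.* α)) (+ j) S n∣ n∣x)
          y , l , y∈B , x+k≡ = christoffel⇐ m (q ℕ.* β) qβ≤m qβ<m (x + k) j′ j′<qβ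
            (∣-residue (x + k) (+ (q ℕ.* β)) (+ j′) S′ m∣ (∣-translate x k (+ j′) S′ m∣x))
      in disjoint x (x∈A , y - k , l , (y , y∈B , refl) , translate-back x y (+ m * l) k x+k≡)

-- Modulo `p`, the relations give `j β - k α ≡ α + e Q α β`, the unknown `x` cancelling. As
-- `e ≡ 1 - r` and `Q r ≡ 1`, the factor `e Q` is `Q - 1`. The last summand keeps track of the
-- multiple of `p`.
common⇒difference-identity : ∀ α β Q s s′ x e j j′ k r i p e₁ e₂ e₃ →
  s ≡ Q * α → s′ ≡ Q * β → e ≡ - (r - 1ℤ) + i * p → 1ℤ + j′ + k ≡ s′ →
  Q * r - 1ℤ ≡ e₃ * p → x * s + j ≡ e₁ * p → (- 1ℤ - (x + e)) * s′ + j′ ≡ e₂ * p →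
  j * β - k * α ≡ α + (Q - 1ℤ) * (α * β) + (e₁ * β + e₂ * α + (i * Q - e₃) * (α * β)) * p
common⇒difference-identity α β Q s s′ x e j j′ k r i p e₁ e₂ e₃ s≡ s′≡ e≡ k≡ r≡ eq₁ eq₂ = begin
  j * β - k * α
    ≡⟨ expand α β s s′ x e j j′ k ⟩
  (x * s + j) * β + ((- 1ℤ - (x + e)) * s′ + j′) * α - x * s * β + (1ℤ + x + e) * s′ * α - (1ℤ + j′ + k) * α + α
    ≡⟨ cong₂ (λ u v → u * β + v * α - x * s * β + (1ℤ + x + e) * s′ * α - (1ℤ + j′ + k) * α + α) eq₁ eq₂ ⟩
  e₁ * p * β + e₂ * p * α - x * s * β + (1ℤ + x + e) * s′ * α - (1ℤ + j′ + k) * α + α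
    ≡⟨ cong₂ (λ u v → e₁ * p * β + e₂ * p * α - x * u * β + (1ℤ + x + e) * s′ * α - v * α + α) s≡ k≡ ⟩
  e₁ * p * β + e₂ * p * α - x * (Q * α) * β + (1ℤ + x + e) * s′ * α - s′ * α + α
    ≡⟨ cong (λ v → e₁ * p * β + e₂ * p * α - x * (Q * α) * β + (1ℤ + x + e) * v * α - v * α + α) s′≡ ⟩
  e₁ * p * β + e₂ * p * α - x * (Q * α) * β + (1ℤ + x + e) * (Q * β) * α - Q * β * α + α
    ≡⟨ cancel α β Q x e p e₁ e₂ ⟩
  (e₁ * β + e₂ * α) * p + e * Q * (α * β) + α
    ≡⟨ cong (λ e → (e₁ * β + e₂ * α) * p + e * Q * (α * β) + α) e≡ ⟩
  (e₁ * β + e₂ * α) * p + (- (r - 1ℤ) + i * p) * Q * (α * β) + α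
    ≡⟨ split (e₁ * β + e₂ * α) Q r i p (α * β) α ⟩
  α + (Q - 1ℤ) * (α * β) + ((e₁ * β + e₂ * α + i * Q * (α * β)) * p - (Q * r - 1ℤ) * (α * β))
    ≡⟨ cong (λ u → α + (Q - 1ℤ) * (α * β) + ((e₁ * β + e₂ * α + i * Q * (α * β)) * p - u * (α * β))) r≡ ⟩
  α + (Q - 1ℤ) * (α * β) + ((e₁ * β + e₂ * α + i * Q * (α * β)) * p - e₃ * p * (α * β))
    ≡⟨ cong (λ u → α + (Q - 1ℤ) * (α * β) + u) (collect (e₁ * β + e₂ * α) (i * Q) e₃ p (α * β)) ⟩
  α + (Q - 1ℤ) * (α * β) + (e₁ * β + e₂ * α + (i * Q - e₃) * (α * β)) * p ∎
  where
  open ≡-Reasoning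
  expand : ∀ α β s s′ x e j j′ k → j * β - k * α ≡
    (x * s + j) * β + ((- 1ℤ - (x + e)) * s′ + j′) * α - x * s * β + (1ℤ + x + e) * s′ * α - (1ℤ + j′ + k) * α + α
  expand = solve-∀
  cancel : ∀ α β Q x e p e₁ e₂ →
    e₁ * p * β + e₂ * p * α - x * (Q * α) * β + (1ℤ + x + e) * (Q * β) * α - Q * β * α + α ≡
    (e₁ * β + e₂ * α) * p + e * Q * (α * β) + α
  cancel = solve-∀
  split : ∀ f Q r i p g α → f * p + (- (r - 1ℤ) + i * p) * Q * g + α ≡
    α + (Q - 1ℤ) * g + ((f + i * Q * g) * p - (Q * r - 1ℤ) * g)
  split = solve-∀
  collect : ∀ f h e₃ p g → (f + h * g) * p - e₃ * p * g ≡ (f + (h - e₃) * g) * p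
  collect = solve-∀

common⇒difference : ∀ p q α β r i x {j j′} →
  + p ∣ + suc q * r - 1ℤ →
  j < suc q ℕ.* α → + p ∣ x * + (suc q ℕ.* α) + + j →
  j′ < suc q ℕ.* β → + p ∣ (- 1ℤ - (x + (- (r - 1ℤ) + i * + p))) * + (suc q ℕ.* β) + + j′ →
  ∃[ t ] Difference (suc q) α β (+ α + + q * (+ α * + β) + t * + p)
common⇒difference p q α β r i x {j} {j′} (divides e₃ qr-1≡) j<qα (divides e₁ eq₁) j′<qβ (divides e₂ eq₂) =
  -- Taking `k = s′ - 1 - j′`, with `s′` the number of letters `b`, turns the sum `j β + j′ α`
  -- produced by the reflection into a difference.
  let k , j′+k≡ = ℕ.m≤n⇒∃[o]m+o≡n j′<qβ
  in e₁ * + β + e₂ * + α + (i * + suc q - e₃) * (+ α * + β)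
     , j , k , j<qα , subst (k <_) j′+k≡ (ℕ.m<n+m k ℕ.z<s)
     , sym (common⇒difference-identity (+ α) (+ β) (+ suc q) (+ (suc q ℕ.* α)) (+ (suc q ℕ.* β)) x
         (- (r - 1ℤ) + i * + p) (+ j) (+ j′) (+ k) r i (+ p) e₁ e₂ e₃
         (ℤ.pos-* (suc q) α) (ℤ.pos-* (suc q) β) refl (cong +_ j′+k≡) qr-1≡ eq₁ eq₂)

theorem4p4 : (n m : ℕ) .{{_ : NonZero n}} .{{_ : NonZero m}} (q α β : ℕ) →
    gcd α β ≡ 1 →
    q ℕ.* α ≤ n → gcd n (q ℕ.* α) ≡ 1 →
    q ℕ.* β ≤ m → gcd m (q ℕ.* β) ≡ 1 →
    Superimposable (christoffel a n (q ℕ.* α)) (christoffel b m (q ℕ.* β)) →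
    let p = gcd m n in
    (r : ℤ) → (+ p) ℤ.∣ (+ q ℤ.* r ℤ.- 1ℤ) →
    (i : ℤ) → 0ℤ ℤ.≤ i → i ℤ.< + (m / p) →
    PerfectlySuperimposable
    (christoffel a n (q ℕ.* α))
    (γ^ (ℤ.- (r ℤ.- 1ℤ) ℤ.+ i ℤ.* + p) · reverse (christoffel b m (q ℕ.* β)))
-- For `q = 0` the first word contains no `a`.
theorem4p4 n m zero α β _ qα≤n _ _ _ _ r _ i _ _ x (x∈A , _) =
  let _ , _ , j<0 , _ = christoffel⇒ n 0 qα≤n (λ ()) x x∈A in contradiction j<0 ℕ.n≮0
theorem4p4 n m (suc q) α β gcd≡1 qα≤n n⊥qα qβ≤m m⊥qβ sup r p∣ i _ _ x (x∈A , x∈B) =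
  let v = christoffel b m (suc q ℕ.* β)
      e = - (r - 1ℤ) + i * + gcd m n
      qα<n , j , j<qα , n∣ = christoffel⇒ n (suc q ℕ.* α) qα≤n (λ ()) x x∈A
      -- Undoing the rotation moves `x` to `x + e`; undoing the reversal reflects that to
      -- `-1 - (x + e)`.
      qβ<m , j′ , j′<qβ , m∣ = christoffel⇒ m (suc q ℕ.* β) qβ≤m (λ ()) (- 1ℤ - (x + e))
        (Occurs-reverse b v (x + e) (Occurs-γ^ b e (reverse v) x x∈B))
      -- The bounds on `j` and `j′` obtained from the common position force both factors to be
      -- positive.
      instance
        α≢0 : NonZero α
        α≢0 = ℕ.m*n≢0⇒n≢0 (suc q) {{ℕ.>-nonZero (ℕ.≤-<-trans ℕ.z≤n j<qα)}}
        β≢0 : NonZero β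
        β≢0 = ℕ.m*n≢0⇒n≢0 (suc q) {{ℕ.>-nonZero (ℕ.≤-<-trans ℕ.z≤n j′<qβ)}}
      K , K∉D = superimposable⇒nonDifferences n m (suc q) α β qα≤n n⊥qα qβ≤m m⊥qβ qα<n qβ<m sup
      -- The class of `K` fixes the form of `p`, and that form excludes the difference found at the
      -- common position.
      X , Y , p≡ = nonDifferences⇒period q α β (gcd m n) gcd≡1 K K∉D
      t , t∈D = common⇒difference (gcd m n) q α β r i x
        (ℤˢ.∣ᵤ⇒∣ {+ gcd m n} {+ suc q * r - 1ℤ} p∣)
        j<qα (ℤˢ.∣-trans (+gcd∣+n m n) n∣) j′<qβ (ℤˢ.∣-trans (+gcd∣+m m n) m∣)
  in period⇒nonDifference q α β (gcd m n) X Y gcd≡1 p≡ t t∈D
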